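{- Let $(G,\lambda)$ be an edge-labeled finite simple graph. Then $\lambda$ is an MAT-labeling of $G$ if and only if there exists an MAT-perfect elimination ordering of $(G,\lambda)$.
   Context: An edge-labeled graph is a simple graph $G$ with a map $\lambda:E_G\to\mathbb{Z}_{>0}$. MAT-labeling: put $\pi_k=\lambda^{ -1}(k)$, $E_k=\pi_1\sqcup\dots\sqcup\pi_k$, $E_0=\varnothing$; $\operatorname{cl}(F)$ is the set of edges whose endvertices are joined by a path of edges in $F$; $\lambda$ is an MAT-labeling if for all $k\ge1$: (ML1) $\pi_k$ is a forest; (ML2) $\operatorname{cl}(\pi_k)\cap E_{k-1}=\varnothing$; (ML3) each $\{u,u'\}\in\pi_k$ has exactly $k-1$ vertices $w$ with $\{u,w\},\{u',w\}\in E_{k-1}$. A vertex $v$ is MAT-simplicial in $(G,\lambda)$ if: (MS1) $N_G(v)$ is a clique; (MS2) $\{\lambda(\{u,v\})\mid u\in N_G(v)\}=\{1,\dots,\deg_G(v)\}$; (MS3) for distinct $u_1,u_2\in N_G(v)$, $\lambda(\{u_1,u_2\})<\max\{\lambda(\{u_1,v\}),\lambda(\{u_2,v\})\}$. An ordering $(v_1,\dots,v_\ell)$ of $V_G$ is an MAT-perfect elimination ordering (MAT-PEO) of $(G,\lambda)$ if for each $i\in[\ell]$, $v_i$ is MAT-simplicial in $(G_i,\lambda_i)$, where $G_i=G[\{v_1,\dots,v_i\}]$ and $\lambda_i=\lambda|_{E_{G_i}}$. -}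

module Defs where

open import Data.Nat using (ℕ; zero; suc; _+_; _∸_; _≤_; _<_; _≤ᵇ_; _⊔_)
open import Data.Nat.Properties using ()
open import Data.Fin using (Fin; toℕ; fromℕ; inject₁; inject≤) renaming (zero to fzero; suc to fsuc)
open import Data.Fin.Properties using (toℕ<n)
open import Data.Bool using (Bool; true; false; _∧_; T)
open import Data.List using (List; length; filterᵇ)
open import Data.List.Base using ()
open import Data.Vec.Functional using ()
open import Data.Fin.Base using ()
open import Data.List using () renaming (map to lmap)
open import Data.Product using (Σ; ∃; _×_; _,_)
open import Data.Empty using (⊥)
open import Relation.Binary.PropositionalEquality using (_≡_; _≢_)
open import Relation.Binary.Construct.Closure.ReflexiveTransitive using (Star)
open import Function.Definitions using (Injective)
open import Data.List using () renaming ([] to nil)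
import Data.List as L

-- Edge-labeled finite simple graphs.
-- Vertices are Fin n.  The labeled edge set is encoded by a symmetric
-- function lab : Fin n → Fin n → ℕ with lab v v ≡ 0:
--   lab u v ≡ 0      means  {u,v} is not an edge,
--   lab u v ≡ suc k  means  {u,v} is an edge with label λ({u,v}) = suc k.
-- This is exactly a simple graph G together with λ : E_G → ℤ_{>0}.

record LGraph : Set where
  field
    n     : ℕ
    lab   : Fin n → Fin n → ℕ
    sym   : ∀ u v → lab u v ≡ lab v u
    irrefl : ∀ v → lab v v ≡ 0
open LGraph public

module _ (G : LGraph) where

  Edge : Fin (n G) → Fin (n G) → Set
  Edge u v = 1 ≤ lab G u v

  InPi : ℕ → Fin (n G) → Fin (n G) → Set
  InPi k u v = Edge u v × lab G u v ≡ k

  InE : ℕ → Fin (n G) → Fin (n G) → Set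
  InE k u v = Edge u v × lab G u v ≤ k

  inEᵇ : ℕ → Fin (n G) → Fin (n G) → Bool
  inEᵇ k u v = (1 ≤ᵇ lab G u v) ∧ (lab G u v ≤ᵇ k)

  vertices : List (Fin (n G))
  vertices = L.allFin (n G)

  HasCycle : (Fin (n G) → Fin (n G) → Set) → Set
  HasCycle F = Σ ℕ λ m → Σ (Fin (3 + m) → Fin (n G)) λ c →
      Injective _≡_ _≡_ c
    × (∀ (i : Fin (2 + m)) → F (c (inject₁ i)) (c (fsuc i)))
    × F (c (fromℕ (2 + m))) (c fzero)

  IsForest : (Fin (n G) → Fin (n G) → Set) → Set
  IsForest F = HasCycle F → ⊥

  InCl : (Fin (n G) → Fin (n G) → Set) → Fin (n G) → Fin (n G) → Set
  InCl F u v = Edge u v × Star F u v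

  commonE : ℕ → Fin (n G) → Fin (n G) → ℕ
  commonE j u u' = length (filterᵇ (λ w → inEᵇ j u w ∧ inEᵇ j u' w) vertices)

  IsMATLabeling : Set
  IsMATLabeling = ∀ (k : ℕ) → 1 ≤ k →
      IsForest (InPi k)
    × (∀ u v → InCl (InPi k) u v → InE (k ∸ 1) u v → ⊥)
    × (∀ u u' → InPi k u u' → commonE (k ∸ 1) u u' ≡ k ∸ 1)

  deg : Fin (n G) → ℕ
  deg v = length (filterᵇ (λ u → 1 ≤ᵇ lab G v u) vertices)

  IsMATSimplicial : Fin (n G) → Set
  IsMATSimplicial v =
      (∀ u₁ u₂ → Edge u₁ v → Edge u₂ v → u₁ ≢ u₂ → Edge u₁ u₂)
    × (∀ u → Edge u v → lab G u v ≤ deg v)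
    × (∀ j → 1 ≤ j → j ≤ deg v → ∃ λ u → Edge u v × lab G u v ≡ j)
    × (∀ u₁ u₂ → Edge u₁ v → Edge u₂ v → u₁ ≢ u₂ →
         lab G u₁ u₂ < lab G u₁ v ⊔ lab G u₂ v)

-- Induced labeled subgraph on the first i+1 vertices of an ordering σ
-- (σ p = the vertex at position p).  Its vertex set is Fin (suc (toℕ i)),
-- vertex a of it being σ at position a.
prefixGraph : (G : LGraph) → (Fin (n G) → Fin (n G)) → Fin (n G) → LGraph
prefixGraph G σ i = record
  { n = suc (toℕ i)
  ; lab = λ a b → lab G (σ (inject≤ a (toℕ<n i))) (σ (inject≤ b (toℕ<n i)))
  ; sym = λ a b → sym G _ _
  ; irrefl = λ a → irrefl G _
  }

-- An ordering (v_1,...,v_ℓ) of V_G, given as an injective (hence bijective)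
-- map σ : Fin ℓ → V_G from positions to vertices, is an MAT-PEO if every
-- v_i = σ i is MAT-simplicial in G_i = G[{v_1,...,v_i}] with λ_i = λ|_{E_{G_i}}.
IsMATPEO : (G : LGraph) → (Fin (n G) → Fin (n G)) → Set
IsMATPEO G σ = Injective _≡_ _≡_ σ ×
  (∀ (i : Fin (n G)) → IsMATSimplicial (prefixGraph G σ i) (fromℕ (toℕ i)))

{-# OPTIONS --safe #-}
module Submission where

-- In an MAT-labeled graph a vertex is MAT-simplicial as soon as the labels at it are pairwise
-- distinct: by (ML3) an edge vu of label k has k − 1 common neighbours whose labels at v are < k,
-- and pigeonhole makes these all the neighbours of v with label < k.
--
-- Existence of such a vertex different from a given x, by induction on the largest label m + 1
-- and on the number of vertices: let B be the set of vertices ≠ x whose labels are distinct once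
-- the edges of label m + 1 are dropped, but not before.  Each r ∈ B has at least two neighbours
-- in the forest π_{m+1}, and they are adjacent to all lower neighbours of r.  Deleting B leaves
-- an MAT-labeled graph, which has a vertex z ≠ x with distinct labels.  If z were a lower
-- neighbour of some r ∈ B, following π_{m+1} from r until it leaves B at two places would give
-- two neighbours of z outside B that are adjacent by simpliciality of z, but cannot be, by (ML1)
-- and (ML2).  So z has distinct labels in the whole graph.
--
-- Conversely, adding an MAT-simplicial vertex v preserves (ML1)-(ML3), since v is a leaf or
-- isolated in every π_k and, by (MS3), creates no new low triangle over an old edge.

open import Defs
open import Data.Bool using (T; _∧_; if_then_else_)
open import Data.Bool.Properties using (T?; T-∧)
open import Data.Fin using (Fin; toℕ; fromℕ; fromℕ<; inject₁; inject≤)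
import Data.Fin.Properties as Fin
open import Data.Fin.Relation.Unary.Top using (view; ‵fromℕ; ‵inject₁)
open import Data.List using (List; []; _∷_; length; lookup; filter; applyUpTo; allFin)
open import Data.List.Membership.Propositional using (_∈_; lose)
open import Data.List.Membership.Propositional.Properties using (∈-lookup; ∈-applyUpTo⁺; ∈-applyUpTo⁻; ∈-filter⁺; ∈-filter⁻; ∈-allFin)
import Data.List.Membership.Setoid.Properties as Setoid∈
open import Data.List.Properties using (length-applyUpTo; length-tabulate; filter-≐; filter-notAll)
open import Data.List.Relation.Binary.Subset.Propositional using (_⊆_)
open import Data.List.Relation.Unary.All using (All; []; _∷_)
import Data.List.Relation.Unary.All as All
open import Data.List.Relation.Unary.AllPairs using ([]; _∷_)
open import Data.List.Relation.Unary.Any using (here; there; index)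
open import Data.List.Relation.Unary.Linked using (Linked; [-]; _∷_)
open import Data.List.Relation.Unary.Unique.Propositional using (Unique)
import Data.List.Relation.Unary.Unique.Propositional.Properties as Unique
open import Data.Nat using (ℕ; zero; suc; _+_; _≤_; _<_; _⊔_; z≤n; s≤s; _≤ᵇ_)
open import Data.Nat.Properties using (≤-refl; ≤-reflexive; ≤-trans; ≤-antisym; ≤-pred; <⇒≤; <⇒≢; ≰⇒>; <-cmp; n≮n; n≤1+n; n<1+n; m≤n⇒m≤1+n; m≤n⇒m<n∨m≡n; m≤m+n; m≤n+m; +-suc; +-identityʳ; m≤m⊔n; m≤n⊔m; m≤n⇒m≤n⊔o; m≤n⇒m≤o⊔n; ⊔-lub; suc-injective; _≟_; _≤?_; ≤ᵇ⇒≤; ≤⇒≤ᵇ)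
open import Data.Product using (Σ; ∃; ∃₂; _×_; _,_; proj₁; proj₂; swap)
open import Data.Sum using (inj₁; inj₂)
open import Data.Vec.Functional using (updateAt)
open import Data.Vec.Functional.Properties using (updateAt-updates; updateAt-minimal)
open import Function using (_∘_; id; const)
open import Function.Bundles using (_⇔_; mk⇔; Equivalence)
open import Function.Definitions using (Injective)
open import Relation.Binary.Construct.Closure.ReflexiveTransitive using (Star; ε; _◅_)
import Relation.Binary.Construct.Closure.ReflexiveTransitive as Star
open import Relation.Binary.Definitions using (tri<; tri≈; tri>)
open import Relation.Binary.PropositionalEquality using (_≡_; _≢_; refl; trans; cong; cong₂; subst; subst₂; setoid) renaming (sym to ≡-sym)
open import Relation.Nullary using (¬_; Dec; yes; no; does; contradiction)
open import Relation.Nullary.Decidable using (_×-dec_; ¬?; dec-true; dec-false; decidable-stable; does-⇔)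

-- Pigeonhole for lists

lookup-injective : ∀ {A : Set} {xs : List A} → Unique xs → Injective _≡_ _≡_ (lookup xs)
lookup-injective (px ∷ pxs) {Fin.zero}  {Fin.zero}  eq = refl
lookup-injective (px ∷ pxs) {Fin.zero}  {Fin.suc j} eq = contradiction eq (All.lookup px (∈-lookup j))
lookup-injective (px ∷ pxs) {Fin.suc i} {Fin.zero}  eq = contradiction (≡-sym eq) (All.lookup px (∈-lookup i))
lookup-injective (px ∷ pxs) {Fin.suc i} {Fin.suc j} eq = cong Fin.suc (lookup-injective pxs eq)

-- The position in `ys` of the chosen partner is injective in the position in `xs`. A relation
-- instead of a function lets the same count run from vertices to labels and from labels to
-- vertices.
length-≤ : ∀ {A B : Set} (R : A → B → Set) {xs : List A} {ys : List B} → Unique xs →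
           (∀ {x} → x ∈ xs → ∃ λ y → y ∈ ys × R x y) →
           (∀ {x x′ y} → x ∈ xs → x′ ∈ xs → R x y → R x′ y → x ≡ x′) →
           length xs ≤ length ys
length-≤ {A} {B} R {xs} {ys} uniq image inj = Fin.injective⇒≤ {f = f} f-injective
  where
  f : Fin (length xs) → Fin (length ys)
  f i = index (proj₁ (proj₂ (image (∈-lookup {xs = xs} i))))

  f-injective : Injective _≡_ _≡_ f
  f-injective {i} {j} fi≡fj
    with y  , y∈  , r  ← image (∈-lookup {xs = xs} i)
       | y′ , y′∈ , r′ ← image (∈-lookup {xs = xs} j)
    with refl ← Setoid∈.index-injective (setoid B) y∈ y′∈ fi≡fj
    = lookup-injective uniq (inj (∈-lookup i) (∈-lookup j) r r′)

range : ℕ → List ℕ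
range = applyUpTo suc

∈-range⁺ : ∀ {k a} → 1 ≤ a → a ≤ k → a ∈ range k
∈-range⁺ (s≤s _) a≤k = ∈-applyUpTo⁺ suc a≤k

∈-range⁻ : ∀ {k a} → a ∈ range k → 1 ≤ a × a ≤ k
∈-range⁻ {k} a∈ with i , i<k , refl ← ∈-applyUpTo⁻ suc {n = k} a∈ = s≤s z≤n , i<k

range-unique : ∀ k → Unique (range k)
range-unique k = Unique.applyUpTo⁺₁ suc k (λ i<j _ eq → n≮n _ (subst (_ <_) (≡-sym (suc-injective eq)) i<j))

-- Labeled graphs and their common neighbours

-- Labelings of a fixed vertex set, so that subgraphs keep their vertices.
record Labeling (N : ℕ) : Set where
  field
    label        : Fin N → Fin N → ℕ
    label-sym    : ∀ u v → label u v ≡ label v u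
    label-irrefl : ∀ v → label v v ≡ 0
open Labeling

toGraph : ∀ {N} → Labeling N → LGraph
toGraph {N} Λ = record { n = N ; lab = label Λ ; sym = label-sym Λ ; irrefl = label-irrefl Λ }

fromGraph : (G : LGraph) → Labeling (n G)
fromGraph G = record { label = lab G ; label-sym = sym G ; label-irrefl = irrefl G }

module _ {N : ℕ} (Λ : Labeling N) where

  Adj : Fin N → Fin N → Set
  Adj = Edge (toGraph Λ)

  Adj≤ : ℕ → Fin N → Fin N → Set
  Adj≤ = InE (toGraph Λ)

  Adj≡ : ℕ → Fin N → Fin N → Set
  Adj≡ = InPi (toGraph Λ)

  MAT : Set
  MAT = IsMATLabeling (toGraph Λ)

  common? : ∀ j u u′ (w : Fin N) → Dec (T (inEᵇ (toGraph Λ) j u w ∧ inEᵇ (toGraph Λ) j u′ w))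
  common? j u u′ w = T? _

  common : ℕ → Fin N → Fin N → List (Fin N)
  common j u u′ = filter (common? j u u′) (vertices (toGraph Λ))

  Clash : Fin N → Set
  Clash v = ∃₂ λ u u′ → u ≢ u′ × Adj u v × label Λ u v ≡ label Λ u′ v

  -- The bound `j` allows pigeonhole at a vertex of which only the labels up to `j` are known to be
  -- distinct, as for the vertices of B. Equal labels carry adjacency from `u` over to `u′`, here
  -- and in `Clash`.
  Distinct≤ : ℕ → Fin N → Set
  Distinct≤ j v = ∀ {u u′} → Adj≤ j u v → label Λ u v ≡ label Λ u′ v → u ≡ u′

  -- Condition (MS2) is replaced by an equivalent one that does not mention the degree.
  record Simplicial (v : Fin N) : Set where
    field
      clique   : ∀ {u u′} → Adj u v → Adj u′ v → u ≢ u′ → Adj u u′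
      nested   : ∀ {u u′} → Adj u v → Adj u′ v → u ≢ u′ → label Λ u u′ < label Λ u v ⊔ label Λ u′ v
      distinct : ¬ Clash v
      downward : ∀ {u j} → 1 ≤ j → j ≤ label Λ u v → ∃ λ u′ → Adj u′ v × label Λ u′ v ≡ j
open Simplicial

module _ {N : ℕ} (Λ : Labeling N) where

  adj-sym : ∀ {u v} → Adj Λ u v → Adj Λ v u
  adj-sym = subst (1 ≤_) (label-sym Λ _ _)

  adj≤-sym : ∀ {j u v} → Adj≤ Λ j u v → Adj≤ Λ j v u
  adj≤-sym (e , l) = adj-sym e , subst (_≤ _) (label-sym Λ _ _) l

  adj≡-sym : ∀ {j u v} → Adj≡ Λ j u v → Adj≡ Λ j v u
  adj≡-sym (e , l) = adj-sym e , trans (label-sym Λ _ _) l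

  adj⇒≢ : ∀ {u v} → Adj Λ u v → u ≢ v
  adj⇒≢ {u} e refl = contradiction (subst (1 ≤_) (label-irrefl Λ u) e) λ ()

  adj≤? : ∀ j u v → Dec (Adj≤ Λ j u v)
  adj≤? j u v = (1 ≤? label Λ u v) ×-dec (label Λ u v ≤? j)

  clash? : ∀ v → Dec (Clash Λ v)
  clash? v = Fin.any? λ u → Fin.any? λ u′ →
    ¬? (u Fin.≟ u′) ×-dec (1 ≤? label Λ u v) ×-dec (label Λ u v ≟ label Λ u′ v)

  ¬clash⇒distinct : ∀ {v} → ¬ Clash Λ v → ∀ {j} → Distinct≤ Λ j v
  ¬clash⇒distinct ¬clash {j} {u} {u′} (e , _) eq with u Fin.≟ u′
  ... | yes u≡u′ = u≡u′
  ... | no  u≢u′ = contradiction (u , u′ , u≢u′ , e , eq) ¬clash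

  T-inE : ∀ {j u w} → T (inEᵇ (toGraph Λ) j u w) ⇔ Adj≤ Λ j u w
  T-inE = mk⇔ (λ t → let a , b = Equivalence.to T-∧ t in ≤ᵇ⇒≤ 1 _ a , ≤ᵇ⇒≤ _ _ b)
              (λ (a , b) → Equivalence.from T-∧ (≤⇒≤ᵇ a , ≤⇒≤ᵇ b))

  T-common : ∀ {j u u′ w} → T (inEᵇ (toGraph Λ) j u w ∧ inEᵇ (toGraph Λ) j u′ w) ⇔ (Adj≤ Λ j u w × Adj≤ Λ j u′ w)
  T-common {j} {u} {u′} {w} =
    mk⇔ (λ t → let a , b = Equivalence.to T-∧ t in Equivalence.to T-inE a , Equivalence.to T-inE b)
        (λ (a , b) → Equivalence.from T-∧ (Equivalence.from (T-inE {j} {u} {w}) a , Equivalence.from (T-inE {j} {u′} {w}) b))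

  ∈-common⁻ : ∀ {j u u′ w} → w ∈ common Λ j u u′ → Adj≤ Λ j u w × Adj≤ Λ j u′ w
  ∈-common⁻ {j} {u} {u′} w∈ =
    Equivalence.to (T-common {j} {u} {u′}) (proj₂ (∈-filter⁻ (common? Λ j u u′) {xs = allFin N} w∈))

  ∈-common⁺ : ∀ {j u u′ w} → Adj≤ Λ j u w → Adj≤ Λ j u′ w → w ∈ common Λ j u u′
  ∈-common⁺ {j} {u} {u′} a b =
    ∈-filter⁺ (common? Λ j u u′) (∈-allFin _) (Equivalence.from (T-common {j} {u} {u′}) (a , b))

  common-unique : ∀ j u u′ → Unique (common Λ j u u′)
  common-unique j u u′ = Unique.filter⁺ (common? Λ j u u′) (Unique.allFin⁺ N)

common-cong : ∀ {N} (Λ Λ′ : Labeling N) {j u u′ x x′} →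
              (∀ {w} → Adj≤ Λ j u w → Adj≤ Λ j u′ w → Adj≤ Λ′ j x w × Adj≤ Λ′ j x′ w) →
              (∀ {w} → Adj≤ Λ′ j x w → Adj≤ Λ′ j x′ w → Adj≤ Λ j u w × Adj≤ Λ j u′ w) →
              length (common Λ j u u′) ≡ length (common Λ′ j x x′)
common-cong {N} Λ Λ′ {j} {u} {u′} {x} {x′} to from =
  cong length (filter-≐ (common? Λ j u u′) (common? Λ′ j x x′)
    ( (λ {w} t → let a , b = Equivalence.to (T-common Λ {j} {u} {u′} {w}) t in
               Equivalence.from (T-common Λ′ {j} {x} {x′} {w}) (to a b))
    , (λ {w} t → let a , b = Equivalence.to (T-common Λ′ {j} {x} {x′} {w}) t in
               Equivalence.from (T-common Λ {j} {u} {u′} {w}) (from a b)))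
    (allFin N))

-- Distinct labels at a vertex of an MAT-labeled graph

module _ {N : ℕ} (Λ : Labeling N) (mat : MAT Λ) where

  forest : ∀ j → IsForest (toGraph Λ) (Adj≡ Λ (suc j))
  forest j = proj₁ (mat (suc j) (s≤s z≤n))

  closed : ∀ {j u v} → Star (Adj≡ Λ (suc j)) u v → ¬ Adj≤ Λ j u v
  closed path e = proj₁ (proj₂ (mat _ (s≤s z≤n))) _ _ (proj₁ e , path) e

  common-length : ∀ {j u v} → Adj≡ Λ (suc j) u v → length (common Λ j u v) ≡ j
  common-length e = proj₂ (proj₂ (mat _ (s≤s z≤n))) _ _ e

  -- The j common neighbours of r and c realise j different labels ≤ j at r,
  -- so by pigeonhole there is no other vertex with a label ≤ j at r.
  saturated : ∀ {j r c z} → Distinct≤ Λ j r → Adj≡ Λ (suc j) r c → Adj≤ Λ j z r → Adj≤ Λ j z c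
  saturated {j} {r} {c} {z} distinct rc zr with adj≤? Λ j z c
  ... | yes zc = zc
  ... | no ¬zc = contradiction too-many (n≮n j)
    where
    low : ∀ {x} → x ∈ z ∷ common Λ j r c → Adj≤ Λ j x r
    low (here refl) = zr
    low (there x∈)  = adj≤-sym Λ (proj₁ (∈-common⁻ Λ x∈))

    unique : Unique (z ∷ common Λ j r c)
    unique = All.tabulate (λ { x∈ refl → ¬zc (adj≤-sym Λ (proj₂ (∈-common⁻ Λ {j} {r} {c} x∈))) })
           ∷ common-unique Λ j r c

    too-many : j < j
    too-many = subst₂ _≤_ (cong suc (common-length rc)) (length-applyUpTo suc j)
      (length-≤ (λ x a → label Λ x r ≡ a) unique
        (λ x∈ → _ , ∈-range⁺ (proj₁ (low x∈)) (proj₂ (low x∈)) , refl)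
        (λ x∈ _ eq eq′ → distinct (low x∈) (trans eq (≡-sym eq′))))

  -- The edge `vu′` carries the larger label, so `saturated`, one level below that label, applies to
  -- it and the lower neighbour `u`.
  lower-neighbour : ∀ {j v u u′} → Distinct≤ Λ j v → Adj Λ u v → Adj≤ Λ j u′ v → label Λ u v < label Λ u′ v →
                    Adj Λ u u′ × label Λ u u′ < label Λ u′ v
  lower-neighbour {j} {v} {u} {u′} distinct uv (u′v , u′v≤j) lt with label Λ u′ v in eq
  ... | suc i = let e , l = saturated {i} distinct′ vu′ (uv , ≤-pred lt) in e , s≤s l
    where
    distinct′ : Distinct≤ Λ i v
    distinct′ (e , l) = distinct (e , ≤-trans l (<⇒≤ u′v≤j))

    vu′ : Adj≡ Λ (suc i) v u′
    vu′ = adj≡-sym Λ (subst (1 ≤_) (≡-sym eq) u′v , eq)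

  -- (MS1) and (MS3) in one: `lower-neighbour` is applied to whichever edge has the larger label.
  -- Only labels up to `j` enter, so vertices of B are covered too.
  neighbours-nested : ∀ {j v u u′} → Distinct≤ Λ j v → Adj≤ Λ j u v → Adj≤ Λ j u′ v → u ≢ u′ →
                      Adj Λ u u′ × label Λ u u′ < label Λ u v ⊔ label Λ u′ v
  neighbours-nested {j} {v} {u} {u′} distinct uv u′v u≢u′ with <-cmp (label Λ u v) (label Λ u′ v)
  ... | tri≈ _ eq _ = contradiction (distinct uv eq) u≢u′
  ... | tri< lt _ _ = let e , l = lower-neighbour distinct (proj₁ uv) u′v lt in
                      e , m≤n⇒m≤o⊔n (label Λ u v) l
  ... | tri> _ _ gt = let e , l = lower-neighbour distinct (proj₁ u′v) uv gt in
                      adj-sym Λ e , m≤n⇒m≤n⊔o (label Λ u′ v) (subst (_< label Λ u v) (label-sym Λ u′ u) l)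

  -- If `i` were missing, the k common neighbours over an edge `uv` of label k + 1 would have
  -- distinct labels among the k - 1 other values in 1, ..., k.
  labels-downward : ∀ {j v u i} → Distinct≤ Λ j v → label Λ u v ≤ suc j → 1 ≤ i → i ≤ label Λ u v →
                    ∃ λ u′ → Adj Λ u′ v × label Λ u′ v ≡ i
  labels-downward {j} {v} {u} {i} distinct l≤j 1≤i i≤l with label Λ u v in eq
  ... | zero  = contradiction (≤-trans 1≤i i≤l) λ ()
  ... | suc k with Fin.any? (λ u′ → (1 ≤? label Λ u′ v) ×-dec (label Λ u′ v ≟ i))
  ...   | yes found = found
  ...   | no ¬found = contradiction (≤-trans few too-many) (n≮n _)
    where
    i≤k : i ≤ k
    -- The label k + 1 itself is attained by `u`.
    i≤k with m≤n⇒m<n∨m≡n i≤l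
    ... | inj₁ i<sk = ≤-pred i<sk
    ... | inj₂ refl = contradiction (u , subst (1 ≤_) (≡-sym eq) (s≤s z≤n) , eq) ¬found

    others : List ℕ
    others = filter (λ a → ¬? (a ≟ i)) (range k)

    few : length others < k
    few = subst (length others <_) (length-applyUpTo suc k)
      (filter-notAll (λ a → ¬? (a ≟ i)) (range k) (lose (∈-range⁺ 1≤i i≤k) (λ ≢ → ≢ refl)))

    low : ∀ {x} → x ∈ common Λ k v u → Adj≤ Λ k x v
    low x∈ = adj≤-sym Λ (proj₁ (∈-common⁻ Λ {k} {v} {u} x∈))

    too-many : k ≤ length others
    too-many = subst (_≤ length others)
      (common-length (adj≡-sym Λ (subst (1 ≤_) (≡-sym eq) (s≤s z≤n) , eq)))
      (length-≤ (λ x a → label Λ x v ≡ a) (common-unique Λ k v u)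
        (λ {x} x∈ → _ , ∈-filter⁺ (λ a → ¬? (a ≟ i)) (∈-range⁺ (proj₁ (low x∈)) (proj₂ (low x∈)))
                         (λ eq → ¬found (x , proj₁ (low x∈) , eq)) , refl)
        (λ x∈ _ eq eq′ → distinct (proj₁ (low x∈) , ≤-trans (proj₂ (low x∈)) (≤-pred l≤j)) (trans eq (≡-sym eq′))))

  distinct⇒simplicial : ∀ {v} → ¬ Clash Λ v → Simplicial Λ v
  distinct⇒simplicial {v} ¬clash = record
    { clique   = λ e e′ → proj₁ ∘ pair e e′
    ; nested   = λ e e′ → proj₂ ∘ pair e e′
    ; distinct = ¬clash
    ; downward = labels-downward (¬clash⇒distinct Λ ¬clash) (n≤1+n _)
    }
    where
    pair : ∀ {u u′} → Adj Λ u v → Adj Λ u′ v → u ≢ u′ →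
           Adj Λ u u′ × label Λ u u′ < label Λ u v ⊔ label Λ u′ v
    pair {u} {u′} e e′ = neighbours-nested {label Λ u v ⊔ label Λ u′ v} (¬clash⇒distinct Λ ¬clash)
      (e , m≤m⊔n _ _) (e′ , m≤n⊔m (label Λ u v) _)

-- Simpliciality with and without the degree

module _ {N : ℕ} (Λ : Labeling N) (v : Fin N) where

  neighbour? : ∀ u → Dec (T (1 ≤ᵇ label Λ v u))
  neighbour? u = T? _

  neighbours : List (Fin N)
  neighbours = filter neighbour? (allFin N)

  ∈-neighbours⁺ : ∀ {u} → Adj Λ u v → u ∈ neighbours
  ∈-neighbours⁺ e = ∈-filter⁺ neighbour? (∈-allFin _) (≤⇒≤ᵇ (adj-sym Λ e))

  ∈-neighbours⁻ : ∀ {u} → u ∈ neighbours → Adj Λ u v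
  ∈-neighbours⁻ u∈ = adj-sym Λ (≤ᵇ⇒≤ 1 _ (proj₂ (∈-filter⁻ neighbour? {xs = allFin N} u∈)))

  -- A label l at `v` forces all of 1, ..., l to be attained, hence l ≤ deg v. If j + 1 were
  -- missing, every label would be at most j and, labels being distinct, deg v ≤ j.
  simplicial⇒MATSimplicial : Simplicial Λ v → IsMATSimplicial (toGraph Λ) v
  simplicial⇒MATSimplicial s =
      (λ _ _ → clique s)
    , (λ u _ → subst (_≤ length neighbours) (length-applyUpTo suc (label Λ u v))
        (length-≤ (λ a u′ → label Λ u′ v ≡ a) (range-unique (label Λ u v))
          (λ a∈ → let 1≤a , a≤ = ∈-range⁻ a∈
                      u′ , e , eq = downward s {u} 1≤a a≤
                  in u′ , ∈-neighbours⁺ e , eq)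
          (λ _ _ eq eq′ → trans (≡-sym eq) eq′)))
    , attained
    , (λ _ _ → nested s)
    where
    attained : ∀ j → 1 ≤ j → j ≤ length neighbours → ∃ λ u → Adj Λ u v × label Λ u v ≡ j
    attained (suc j) 1≤j j≤d with Fin.any? (λ u → (1 ≤? label Λ u v) ×-dec (label Λ u v ≟ suc j))
    ... | yes found = found
    ... | no ¬found = contradiction (≤-trans j≤d few) (n≮n j)
      where
      small : ∀ {u} → u ∈ neighbours → label Λ u v ≤ j
      small {u} u∈ with label Λ u v ≤? j
      ... | yes l≤j = l≤j
      ... | no  l≰j = contradiction (downward s 1≤j (≰⇒> l≰j)) ¬found

      few : length neighbours ≤ j
      few = subst (length neighbours ≤_) (length-applyUpTo suc j)
        (length-≤ (λ u a → label Λ u v ≡ a) (Unique.filter⁺ neighbour? (Unique.allFin⁺ N))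
          (λ u∈ → _ , ∈-range⁺ (∈-neighbours⁻ u∈) (small u∈) , refl)
          (λ u∈ _ eq eq′ → ¬clash⇒distinct Λ (distinct s) (∈-neighbours⁻ u∈ , ≤-refl) (trans eq (≡-sym eq′))))

  -- In case of a clash, all labels 1, ..., deg v are still attained without `u`, with `u′` standing
  -- in for it; but that takes deg v vertices.
  MATSimplicial⇒simplicial : IsMATSimplicial (toGraph Λ) v → Simplicial Λ v
  MATSimplicial⇒simplicial (ms1 , bounded , attained , ms3) = record
    { clique   = ms1 _ _
    ; nested   = ms3 _ _
    ; distinct = ¬clash
    ; downward = λ {u} 1≤j j≤l → attained _ 1≤j (≤-trans j≤l (bounded u (≤-trans 1≤j j≤l)))
    }
    where
    ¬clash : ¬ Clash Λ v
    ¬clash (u , u′ , u≢u′ , e , eq) = contradiction (≤-trans few many) (n≮n _)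
      where
      others : List (Fin N)
      others = filter (λ w → ¬? (w Fin.≟ u)) neighbours

      few : length others < length neighbours
      few = filter-notAll (λ w → ¬? (w Fin.≟ u)) neighbours (lose (∈-neighbours⁺ e) (λ ≢ → ≢ refl))

      other : ∀ {j} → 1 ≤ j → j ≤ length neighbours → ∃ λ w → w ∈ others × label Λ w v ≡ j
      other 1≤j j≤d with w , wv , refl ← attained _ 1≤j j≤d with w Fin.≟ u
      ... | no  w≢u  = w , ∈-filter⁺ (λ w → ¬? (w Fin.≟ u)) (∈-neighbours⁺ wv) w≢u , refl
      ... | yes refl = u′ , ∈-filter⁺ (λ w → ¬? (w Fin.≟ u)) (∈-neighbours⁺ (subst (1 ≤_) eq e)) (u≢u′ ∘ ≡-sym) , ≡-sym eq

      many : length neighbours ≤ length others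
      many = subst (_≤ length others) (length-applyUpTo suc (length neighbours))
        (length-≤ (λ a w → label Λ w v ≡ a) (range-unique (length neighbours))
          (λ a∈ → let 1≤a , a≤d = ∈-range⁻ a∈ in other 1≤a a≤d)
          (λ _ _ eq eq′ → trans (≡-sym eq) eq′))

-- Labeled subgraphs

_⊑_ : ∀ {N} → Labeling N → Labeling N → Set
Λ′ ⊑ Λ = ∀ {u v} → Adj Λ′ u v → label Λ′ u v ≡ label Λ u v

module _ {N : ℕ} {Λ′ Λ : Labeling N} (sub : Λ′ ⊑ Λ) where

  ⊑-adj : ∀ {u v} → Adj Λ′ u v → Adj Λ u v
  ⊑-adj e = subst (1 ≤_) (sub e) e

  ⊑-adj≤ : ∀ {j u v} → Adj≤ Λ′ j u v → Adj≤ Λ j u v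
  ⊑-adj≤ (e , l) = ⊑-adj e , subst (_≤ _) (sub e) l

  ⊑-adj≡ : ∀ {j u v} → Adj≡ Λ′ j u v → Adj≡ Λ j u v
  ⊑-adj≡ (e , l) = ⊑-adj e , trans (≡-sym (sub e)) l

  ⊑-adj≤⁻ : ∀ {j u v} → Adj Λ′ u v → Adj≤ Λ j u v → Adj≤ Λ′ j u v
  ⊑-adj≤⁻ e (_ , l) = e , subst (_≤ _) (≡-sym (sub e)) l

  ⊑-adj≡⁻ : ∀ {j u v} → Adj Λ′ u v → Adj≡ Λ j u v → Adj≡ Λ′ j u v
  ⊑-adj≡⁻ e (_ , l) = e , trans (sub e) l

  -- (ML1) and (ML2) pass to every subgraph. Only the count of (ML3) can drop, which the hypothesis
  -- prevents: every low triangle over a surviving edge survives.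
  MAT-⊑ : (∀ {j u u′ w} → Adj≡ Λ′ (suc j) u u′ → Adj≤ Λ j u w → Adj≤ Λ j u′ w → Adj Λ′ u w × Adj Λ′ u′ w) →
          MAT Λ → MAT Λ′
  MAT-⊑ keep mat (suc j) _ =
      (λ (m , c , inj , steps , last) → forest Λ mat j (m , c , inj , ⊑-adj≡ ∘ steps , ⊑-adj≡ last))
    , (λ u v (_ , path) e → closed Λ mat (Star.map ⊑-adj≡ path) (⊑-adj≤ e))
    , (λ u u′ e → trans
        (common-cong Λ′ Λ (λ a b → ⊑-adj≤ a , ⊑-adj≤ b)
          (λ a b → let a′ , b′ = keep e a b in ⊑-adj≤⁻ a′ a , ⊑-adj≤⁻ b′ b))
        (common-length Λ mat (⊑-adj≡ e)))

module _ {N : ℕ} (Λ : Labeling N) {P : Fin N → Fin N → Set}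
         (P? : ∀ u v → Dec (P u v)) (P-sym : ∀ {u v} → P u v → P v u) where

  private
    does-sym : ∀ u v → does (P? u v) ≡ does (P? v u)
    does-sym u v with P? u v
    ... | yes p = ≡-sym (dec-true (P? v u) (P-sym p))
    ... | no ¬p = ≡-sym (dec-false (P? v u) (¬p ∘ P-sym))

  -- Through `does` the label is independent of the proof inside the decision, so equivalent
  -- predicates yield equal labels in `deletion-cong`.
  restrict : Labeling N
  restrict = record
    { label        = λ u v → if does (P? u v) then label Λ u v else 0
    ; label-sym    = restrict-sym
    ; label-irrefl = restrict-irrefl
    }
    where
    restrict-sym : ∀ u v → (if does (P? u v) then label Λ u v else 0) ≡ (if does (P? v u) then label Λ v u else 0)
    restrict-sym u v rewrite does-sym u v | label-sym Λ u v = refl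

    restrict-irrefl : ∀ v → (if does (P? v v) then label Λ v v else 0) ≡ 0
    restrict-irrefl v with P? v v
    ... | yes _ = label-irrefl Λ v
    ... | no  _ = refl

  restrict-⊑ : restrict ⊑ Λ
  restrict-⊑ {u} {v} e with P? u v
  ... | yes _ = refl

  restrict-label : ∀ {u v} → P u v → label restrict u v ≡ label Λ u v
  restrict-label {u} {v} p with P? u v
  ... | yes _ = refl
  ... | no ¬p = contradiction p ¬p

  restrict-adj⁻ : ∀ {u v} → Adj restrict u v → P u v
  restrict-adj⁻ {u} {v} e with P? u v
  ... | yes p = p

  restrict-adj⁺ : ∀ {u v} → P u v → Adj Λ u v → Adj restrict u v
  restrict-adj⁺ p = subst (1 ≤_) (≡-sym (restrict-label p))

-- Adding a simplicial vertex

module _ {N : ℕ} (Λ : Labeling N) {F : Fin N → Fin N → Set} (F-sym : ∀ {u v} → F u v → F v u) where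

  -- Serves to keep a leaf off every cycle.
  cycle-neighbours : (cycle : HasCycle (toGraph Λ) F) → ∀ i → let c = proj₁ (proj₂ cycle) in
                     ∃₂ λ a b → a ≢ b × F a (c i) × F b (c i)
  cycle-neighbours (m , c , inj , steps , last) Fin.zero =
    c (Fin.suc Fin.zero) , c (fromℕ (suc (suc m))) , (λ eq → contradiction (inj eq) λ ()) , F-sym (steps Fin.zero) , last
  cycle-neighbours (m , c , inj , steps , last) (Fin.suc i) with view i
  ... | ‵fromℕ     = c (inject₁ i) , c Fin.zero , (λ eq → contradiction (inj eq) λ ()) , steps i , F-sym last
  -- The neighbouring positions on the cycle are j and j + 2.
  ... | ‵inject₁ j = c (inject₁ i) , c (Fin.suc (Fin.suc j))
    , (λ eq → <⇒≢ (m≤n⇒m≤1+n (n<1+n (toℕ j)))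
        (trans (≡-sym (trans (Fin.toℕ-inject₁ (inject₁ j)) (Fin.toℕ-inject₁ j))) (cong toℕ (inj eq))))
    , steps i , F-sym (steps (Fin.suc j))

  cut-detour : ∀ {v x y} → (∀ {a b} → F a v → F b v → a ≡ b) → x ≢ v → y ≢ v → Star F x y →
               Star (λ a b → F a b × a ≢ v × b ≢ v) x y
  cut-detour leaf x≢v y≢v ε = ε
  cut-detour {v} leaf x≢v y≢v (_◅_ {j = z} xz path) with z Fin.≟ v
  ... | no z≢v = (xz , x≢v , z≢v) ◅ cut-detour leaf z≢v y≢v path
  cut-detour leaf x≢v y≢v (xv ◅ ε)         | yes refl = contradiction refl y≢v
  cut-detour leaf x≢v y≢v (xv ◅ vw ◅ path) | yes refl with refl ← leaf xv (F-sym vw) =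
    cut-detour leaf x≢v y≢v path

-- By (MS3) the label j + 1 of `uu′` would be less than a maximum of labels that are at most j.
-- Hence (ML3) never counts a simplicial vertex.
simplicial-not-below : ∀ {N} {Λ : Labeling N} {v} → Simplicial Λ v → ∀ {j u u′} → Adj≡ Λ (suc j) u u′ → Adj≤ Λ j u v → ¬ Adj≤ Λ j u′ v
simplicial-not-below {Λ = Λ} s {j} uu′ uv u′v = n≮n j (<⇒≤ (≤-trans (s≤s (≤-reflexive (≡-sym (proj₂ uu′))))
  (≤-trans (nested s (proj₁ uv) (proj₁ u′v) (adj⇒≢ Λ (proj₁ uu′))) (⊔-lub (proj₂ uv) (proj₂ u′v)))))

module _ {N : ℕ} {Λ′ Λ : Labeling N} {v : Fin N} (s : Simplicial Λ v) (sub : Λ′ ⊑ Λ)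
         (keep : ∀ {u w} → u ≢ v → w ≢ v → Adj Λ u w → Adj Λ′ u w) (mat : MAT Λ′) where

  private
    keep≤ : ∀ {j u w} → u ≢ v → w ≢ v → Adj≤ Λ j u w → Adj≤ Λ′ j u w
    keep≤ u≢v w≢v e = ⊑-adj≤⁻ {Λ′ = Λ′} {Λ} sub (keep u≢v w≢v (proj₁ e)) e

    keep≡ : ∀ {j u w} → u ≢ v → w ≢ v → Adj≡ Λ j u w → Adj≡ Λ′ j u w
    keep≡ u≢v w≢v e = ⊑-adj≡⁻ {Λ′ = Λ′} {Λ} sub (keep u≢v w≢v (proj₁ e)) e

    leaf : ∀ {j a b} → Adj≡ Λ j a v → Adj≡ Λ j b v → a ≡ b
    leaf (e , l) (_ , l′) = ¬clash⇒distinct Λ (distinct s) (e , ≤-refl) (trans l (≡-sym l′))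

    acyclic : ∀ {j} → IsForest (toGraph Λ) (Adj≡ Λ (suc j))
    acyclic {j} cycle@(m , c , inj , steps , last) with Fin.any? (λ i → c i Fin.≟ v)
    ... | yes (i , refl) = let _ , _ , a≢b , ai , bi = cycle-neighbours Λ {Adj≡ Λ (suc j)} (adj≡-sym Λ) cycle i
                           in a≢b (leaf ai bi)
    ... | no avoid = forest Λ′ mat j
      (m , c , inj , (λ i → keep≡ (avoid ∘ (_ ,_)) (avoid ∘ (_ ,_)) (steps i)) , keep≡ (avoid ∘ (_ ,_)) (avoid ∘ (_ ,_)) last)

    closed-away : ∀ {j x y} → x ≢ v → y ≢ v → Star (Adj≡ Λ (suc j)) x y → ¬ Adj≤ Λ j x y
    closed-away x≢v y≢v path e = closed Λ′ mat
      (Star.map (λ (f , a≢v , b≢v) → keep≡ a≢v b≢v f) (cut-detour Λ (adj≡-sym Λ) leaf x≢v y≢v path))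
      (keep≤ x≢v y≢v e)

    -- If `x` follows `v` on the path, (MS1) and (MS3) give an edge `xy` of label at most j, so
    -- (ML2) would already fail for `x` and `y`, away from `v`.
    closed-from : ∀ {j y} → Star (Adj≡ Λ (suc j)) v y → ¬ Adj≤ Λ j v y
    closed-from ε (e , _) = adj⇒≢ Λ e refl
    closed-from {j} {y} (_◅_ {j = x} vx path) vy =
      closed-away x≢v y≢v path (clique s xv yv x≢y , ≤-pred (≤-trans (nested s xv yv x≢y) (⊔-lub (≤-reflexive (proj₂ (adj≡-sym Λ vx))) (m≤n⇒m≤1+n (proj₂ (adj≤-sym Λ vy))))))
      where
      xv : Adj Λ x v
      xv = adj-sym Λ (proj₁ vx)
      yv : Adj Λ y v
      yv = adj-sym Λ (proj₁ vy)
      x≢v : x ≢ v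
      x≢v = adj⇒≢ Λ xv
      y≢v : y ≢ v
      y≢v = adj⇒≢ Λ yv
      x≢y : x ≢ y
      x≢y refl = n≮n j (subst (_≤ j) (proj₂ vx) (proj₂ vy))

    closed-all : ∀ {j x y} → Star (Adj≡ Λ (suc j)) x y → ¬ Adj≤ Λ j x y
    closed-all {x = x} {y} path e with x Fin.≟ v | y Fin.≟ v
    ... | yes refl | _        = closed-from path e
    ... | no _     | yes refl = closed-from (Star.reverse (adj≡-sym Λ) path) (adj≤-sym Λ e)
    ... | no x≢v   | no y≢v   = closed-away x≢v y≢v path e

    count-away : ∀ {j u u′} → u ≢ v → u′ ≢ v → Adj≡ Λ (suc j) u u′ → length (common Λ j u u′) ≡ j
    count-away {j} {u} {u′} u≢v u′≢v e = trans
      (common-cong Λ Λ′ {j} {u} {u′} {u} {u′}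
        (λ {w} a b → let w≢v : w ≢ v
                         w≢v = λ { refl → simplicial-not-below s e a b }
                     in keep≤ u≢v w≢v a , keep≤ u′≢v w≢v b)
        (λ a b → ⊑-adj≤ {Λ′ = Λ′} {Λ} sub a , ⊑-adj≤ {Λ′ = Λ′} {Λ} sub b))
      (common-length Λ′ mat (keep≡ u≢v u′≢v e))

    -- Taking the label at `v` is a bijection from the common neighbours to 1, ..., j: injective as
    -- labels at `v` are distinct, and onto because `downward` supplies a neighbour of each label,
    -- which (MS1) and (MS3) join to `u` by a low edge.
    count-from : ∀ {j u} → Adj≡ Λ (suc j) v u → length (common Λ j v u) ≡ j
    count-from {j} {u} vu = ≤-antisym
      (subst (length (common Λ j v u) ≤_) (length-applyUpTo suc j)
        (length-≤ (λ w a → label Λ w v ≡ a) (common-unique Λ j v u)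
          (λ w∈ → let e , l = below w∈ in _ , ∈-range⁺ e l , refl)
          (λ w∈ _ eq eq′ → ¬clash⇒distinct Λ (distinct s) (below w∈) (trans eq (≡-sym eq′)))))
      (subst (_≤ length (common Λ j v u)) (length-applyUpTo suc j)
        (length-≤ (λ a w → label Λ w v ≡ a) (range-unique j)
          (λ a∈ → let 1≤a , a≤j = ∈-range⁻ a∈
                      w , wv , eq = downward s {u} 1≤a (≤-trans a≤j (≤-trans (n≤1+n j) (≤-reflexive (≡-sym (proj₂ uv)))))
                  in w , member (wv , subst (_≤ j) (≡-sym eq) a≤j) , eq)
          (λ _ _ eq eq′ → trans (≡-sym eq) eq′)))
      where
      uv : Adj≡ Λ (suc j) u v
      uv = adj≡-sym Λ vu

      below : ∀ {w} → w ∈ common Λ j v u → Adj≤ Λ j w v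
      below w∈ = adj≤-sym Λ (proj₁ (∈-common⁻ Λ {j} {v} {u} w∈))

      member : ∀ {w} → Adj≤ Λ j w v → w ∈ common Λ j v u
      member {w} wv = ∈-common⁺ Λ (adj≤-sym Λ wv) (clique s (proj₁ uv) (proj₁ wv) u≢w ,
        ≤-pred (≤-trans (nested s (proj₁ uv) (proj₁ wv) u≢w) (⊔-lub (≤-reflexive (proj₂ uv)) (m≤n⇒m≤1+n (proj₂ wv)))))
        where
        u≢w : u ≢ w
        u≢w refl = n≮n j (subst (_≤ j) (proj₂ uv) (proj₂ wv))

    count : ∀ {j u u′} → Adj≡ Λ (suc j) u u′ → length (common Λ j u u′) ≡ j
    count {j} {u} {u′} e with u Fin.≟ v | u′ Fin.≟ v
    ... | yes refl | _        = count-from e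
    ... | no _     | yes refl = trans (common-cong Λ Λ {j} {u} {u′} {u′} {u} (λ a b → b , a) (λ a b → b , a)) (count-from (adj≡-sym Λ e))
    ... | no u≢v   | no u′≢v  = count-away u≢v u′≢v e

  MAT-extend : MAT Λ
  MAT-extend (suc j) _ = acyclic , (λ _ _ (_ , path) → closed-all path) , (λ _ _ → count)

-- Paths leaving a set of branching vertices in a forest

linked-lookup : ∀ {A : Set} {F : A → A → Set} {x : A} {xs} → Linked F (x ∷ xs) →
                ∀ i → F (lookup (x ∷ xs) (inject₁ i)) (lookup (x ∷ xs) (Fin.suc i))
linked-lookup (f ∷ fs) Fin.zero    = f
linked-lookup (f ∷ fs) (Fin.suc i) = linked-lookup fs i

linked⇒star : ∀ {A : Set} {F : A → A → Set} {x y : A} {xs} → Linked F (x ∷ xs) → y ∈ x ∷ xs → Star F x y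
linked⇒star fs       (here refl) = ε
linked⇒star (f ∷ fs) (there y∈)  = f ◅ linked⇒star fs y∈

-- Ending exactly at `c` lets an edge from `c` close the path to a cycle; the inclusion keeps it
-- disjoint from vertices put in front of it.
truncate : ∀ {A : Set} {F : A → A → Set} {x c : A} {xs} → Linked F (x ∷ xs) → Unique (x ∷ xs) → c ∈ xs →
           ∃₂ λ y ys → Linked F (x ∷ y ∷ ys) × Unique (x ∷ y ∷ ys) × y ∷ ys ⊆ xs ×
                       lookup (y ∷ ys) (fromℕ (length ys)) ≡ c
truncate (f ∷ _) ((x≢y ∷ _) ∷ _) (here refl) =
  _ , [] , f ∷ [-] , (x≢y ∷ []) ∷ [] ∷ [] , (λ { (here refl) → here refl }) , refl
truncate (f ∷ fs) (x≢ ∷ u) (there c∈) with y , ys , fs′ , u′ , ys⊆ , last ← truncate fs u c∈ =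
  _ , y ∷ ys , f ∷ fs′ , All.tabulate (All.lookup x≢ ∘ grow) ∷ u′ , grow , last
  where
  grow : _ ∷ y ∷ ys ⊆ _
  grow (here refl) = here refl
  grow (there z∈)  = there (ys⊆ z∈)

module _ {N : ℕ} (Λ : Labeling N) {F : Fin N → Fin N → Set} (F-sym : ∀ {u v} → F u v → F v u) where

  -- Since `c` lies beyond `b`, the cycle has at least three vertices.
  close-cycle : ∀ {a b c l} → Linked F (a ∷ b ∷ l) → Unique (a ∷ b ∷ l) → c ∈ l → F c a → HasCycle (toGraph Λ) F
  close-cycle {a} {b} (f ∷ fs) ((a≢b ∷ a≢) ∷ u) c∈ ca with y , ys , fs′ , u′ , ys⊆ , last ← truncate fs u c∈ =
    length ys , lookup (a ∷ b ∷ y ∷ ys)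
    , lookup-injective ((a≢b ∷ All.tabulate (All.lookup a≢ ∘ ys⊆)) ∷ u′)
    , linked-lookup (f ∷ fs′)
    , subst (λ x → F x a) (≡-sym last) ca

  module _ (acyclic : IsForest (toGraph Λ) F) (F-irrefl : ∀ {u v} → F u v → u ≢ v)
           {R A : Fin N → Set} (R? : ∀ u → Dec (R u))
           (branch : ∀ {u} → R u → ∃₂ λ a b → a ≢ b × F a u × F b u)
           (spread : ∀ {u c} → R u → A u → F c u → A c) where

    private
      -- The path grows at its head `a`; `inR` lets a second path branch off at `b`.
      record Path (a b : Fin N) (l : List (Fin N)) : Set where
        constructor path
        field
          linked : Linked F (a ∷ b ∷ l)
          unique : Unique (a ∷ b ∷ l)
          inA    : All A (a ∷ b ∷ l)
          inR    : R b
      open Path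

      another : ∀ {u} → R u → ∀ d → ∃ λ c → c ≢ d × F c u
      another r d with a , b , a≢b , fa , fb ← branch r with a Fin.≟ d
      ... | no  a≢d  = a , a≢d , fa
      ... | yes refl = b , a≢b ∘ ≡-sym , fb

      -- The new vertex avoids `b` by choice, and `l` because meeting it would close a cycle in the
      -- forest.
      step : ∀ {a b l} → Path a b l → R a → ∃ λ c → Path c a (b ∷ l)
      step {a} {b} {l} p ra with c , c≢b , ca ← another ra b =
        c , path (ca ∷ linked p) ((F-irrefl ca ∷ c≢b ∷ All.tabulate c≢l) ∷ unique p)
                 (spread ra (All.head (inA p)) ca ∷ inA p) ra
        where
        c≢l : ∀ {x} → x ∈ l → c ≢ x
        c≢l x∈ refl = acyclic (close-cycle (linked p) (unique p) x∈ ca)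

      -- `k` is fuel: a path without repetition has at most `N` vertices, so its head leaves R
      -- before `k` runs out.
      grow : ∀ k {a b l} → N < k + length (a ∷ b ∷ l) → Path a b l →
             ∃ λ a′ → ∃₂ λ b′ l′ → Path a′ b′ l′ × ¬ R a′ × l ⊆ l′
      grow zero {a} {b} {l} N< p = contradiction (≤-trans N< short) (n≮n N)
        where
        short : length (a ∷ b ∷ l) ≤ N
        short = subst (length (a ∷ b ∷ l) ≤_) (length-tabulate id)
          (length-≤ _≡_ (unique p) (λ _ → _ , ∈-allFin _ , refl) (λ _ _ eq eq′ → trans eq (≡-sym eq′)))
      grow (suc k) {a} {b} {l} N< p with R? a
      ... | no ¬ra = a , b , l , p , ¬ra , id
      ... | yes ra with c , p′ ← step p ra
                   with a′ , b′ , l′ , p″ , ¬r , l⊆ ← grow k (subst (N <_) (≡-sym (+-suc k _)) N<) p′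
                   = a′ , b′ , l′ , p″ , ¬r , l⊆ ∘ there

      extend : ∀ {a b l} → Path a b l → ∃ λ a′ → ∃₂ λ b′ l′ → Path a′ b′ l′ × ¬ R a′ × l ⊆ l′
      extend = grow (suc N) (s≤s (m≤m+n N _))

    -- Follow a path inside R until it leaves R, then turn round and leave R at another place.
    two-exits : ∀ {r} → R r → A r →
                ∃₂ λ y y′ → y ≢ y′ × (¬ R y × A y) × (¬ R y′ × A y′) × Star F y y′ × ¬ F y y′
    two-exits {r} rr ar
      with c , _ , cr ← another rr r
      -- The first walk leaves R at `y′`; only its last edge, coming from `b` in R, is kept.
      with y′ , b , _ , p , ¬ry′ , _ ← extend (path (cr ∷ [-]) ((F-irrefl cr ∷ []) ∷ [] ∷ []) (spread rr ar cr ∷ ar ∷ []) rr)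
      with y′b ∷ _ ← linked p | ay′ ∷ ab ∷ _ ← inA p
      -- The second walk turns round at `b`: begun as `d`, `b`, `y′`, it is prolonged to an exit `y`
      -- with `y′` still on it.
      with d , d≢y′ , db ← another (inR p) y′
      with y , b′ , l , q , ¬ry , l⊆ ← extend (path (db ∷ F-sym y′b ∷ [-])
             ((F-irrefl db ∷ d≢y′ ∷ []) ∷ (F-irrefl (F-sym y′b) ∷ []) ∷ [] ∷ [])
             (spread (inR p) ab db ∷ ab ∷ ay′ ∷ []) (inR p))
      = y , y′ , y≢y′ , (¬ry , All.head (inA q)) , (¬ry′ , ay′)
      , linked⇒star (linked q) (there (there (l⊆ (here refl))))
      , (λ yy′ → acyclic (close-cycle (linked q) (unique q) (l⊆ (here refl)) (F-sym yy′)))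
      where
      y≢y′ : y ≢ y′
      y≢y′ eq with (_ ∷ y≢) ∷ _ ← unique q = All.lookup y≢ (l⊆ (here refl)) eq

-- Truncating labels and deleting vertices

module Truncation {N : ℕ} (Λ : Labeling N) (m : ℕ) where

  small? : ∀ u v → Dec (label Λ u v ≤ m)
  small? u v = label Λ u v ≤? m

  small-sym : ∀ {u v} → label Λ u v ≤ m → label Λ v u ≤ m
  small-sym {u} {v} = subst (_≤ m) (label-sym Λ u v)

  truncation : Labeling N
  truncation = restrict Λ small? small-sym

  truncation-⊑ : truncation ⊑ Λ
  truncation-⊑ = restrict-⊑ Λ small? small-sym

  truncation-adj⁺ : ∀ {u v} → Adj≤ Λ m u v → Adj truncation u v
  truncation-adj⁺ (e , l) = restrict-adj⁺ Λ small? small-sym l e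

  truncation-adj⁻ : ∀ {u v} → Adj truncation u v → Adj≤ Λ m u v
  truncation-adj⁻ e = ⊑-adj {Λ′ = truncation} {Λ} truncation-⊑ e , restrict-adj⁻ Λ small? small-sym e

  truncation-≤ : ∀ u v → label truncation u v ≤ m
  truncation-≤ u v with 1 ≤? label truncation u v
  ... | yes e = subst (_≤ m) (≡-sym (truncation-⊑ e)) (proj₂ (truncation-adj⁻ e))
  ... | no ¬e = ≤-trans (≤-pred (≰⇒> ¬e)) z≤n

  -- A surviving edge has label j + 1 ≤ m, so low triangles over it consist of surviving edges.
  truncation-MAT : MAT Λ → MAT truncation
  truncation-MAT = MAT-⊑ {Λ′ = truncation} {Λ} truncation-⊑ λ (e , l) (a , la) (b , lb) →
    let j<m = subst (_≤ m) (trans (≡-sym (truncation-⊑ e)) l) (proj₂ (truncation-adj⁻ e))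
    in truncation-adj⁺ (a , ≤-trans la (<⇒≤ j<m)) , truncation-adj⁺ (b , ≤-trans lb (<⇒≤ j<m))

  truncation-distinct : ∀ {v} → ¬ Clash truncation v → Distinct≤ Λ m v
  truncation-distinct ¬clash {u} {u′} e eq =
    ¬clash⇒distinct truncation ¬clash (truncation-adj⁺ e , truncation-≤ _ _)
      (trans (truncation-⊑ (truncation-adj⁺ e)) (trans eq (≡-sym (truncation-⊑ (truncation-adj⁺ e′)))))
    where
    e′ : Adj≤ Λ m u′ _
    e′ = subst (λ l → 1 ≤ l × l ≤ m) eq e

module Deletion {N : ℕ} (Λ : Labeling N) {R : Fin N → Set} (R? : ∀ u → Dec (R u)) where

  outside? : ∀ u v → Dec (¬ R u × ¬ R v)
  outside? u v = ¬? (R? u) ×-dec ¬? (R? v)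

  deletion : Labeling N
  deletion = restrict Λ outside? swap

  deletion-⊑ : deletion ⊑ Λ
  deletion-⊑ = restrict-⊑ Λ outside? swap

  deletion-adj⁺ : ∀ {u v} → ¬ R u → ¬ R v → Adj Λ u v → Adj deletion u v
  deletion-adj⁺ ¬ru ¬rv = restrict-adj⁺ Λ outside? swap (¬ru , ¬rv)

  deletion-adj⁻ : ∀ {u v} → Adj deletion u v → ¬ R u × ¬ R v
  deletion-adj⁻ = restrict-adj⁻ Λ outside? swap

  -- A deleted vertex can affect (ML3) only as the apex of a low triangle over a surviving edge,
  -- which the hypothesis excludes.
  deletion-MAT : (∀ {j u u′ r} → R r → Adj≡ Λ (suc j) u u′ → Adj≤ Λ j u r → ¬ Adj≤ Λ j u′ r) →
                 MAT Λ → MAT deletion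
  deletion-MAT free = MAT-⊑ {Λ′ = deletion} {Λ} deletion-⊑ λ e a b →
    let ¬ru , ¬ru′ = deletion-adj⁻ (proj₁ e)
        ¬rw = λ rw → free rw (⊑-adj≡ {Λ′ = deletion} {Λ} deletion-⊑ e) a b
    in deletion-adj⁺ ¬ru ¬rw (proj₁ a) , deletion-adj⁺ ¬ru′ ¬rw (proj₁ b)

module _ {N : ℕ} (Λ : Labeling N) {P Q : Fin N → Set} (P? : ∀ u → Dec (P u)) (Q? : ∀ u → Dec (Q u)) where

  deletion-cong : (∀ {u} → P u → Q u) → (∀ {u} → Q u → P u) →
                  ∀ u v → label (Deletion.deletion Λ P?) u v ≡ label (Deletion.deletion Λ Q?) u v
  deletion-cong to from u v
    rewrite does-⇔ (mk⇔ to from) (P? u) (Q? u) | does-⇔ (mk⇔ to from) (P? v) (Q? v) = refl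

-- Existence of a vertex with distinct labels

module Step {N : ℕ} (Λ : Labeling N) (mat : MAT Λ) (m : ℕ) (bounded : ∀ u v → label Λ u v ≤ suc m) (x : Fin N) where

  open Truncation Λ m

  Bad : Fin N → Set
  Bad u = u ≢ x × ¬ Clash truncation u × Clash Λ u

  bad? : ∀ u → Dec (Bad u)
  bad? u = ¬? (u Fin.≟ x) ×-dec ¬? (clash? truncation u) ×-dec clash? Λ u

  open Deletion Λ bad? public

  -- The labels up to m at `u` are distinct, so a repeated label must be m + 1.
  branch : ∀ {u} → Bad u → ∃₂ λ a b → a ≢ b × Adj≡ Λ (suc m) a u × Adj≡ Λ (suc m) b u
  branch {u} (_ , ¬clash , a , b , a≢b , au , eq) with m≤n⇒m<n∨m≡n (bounded a u)
  ... | inj₁ l≤m = contradiction (truncation-distinct ¬clash (au , ≤-pred l≤m) eq) a≢b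
  ... | inj₂ l≡  = a , b , a≢b , (au , l≡) , (subst (1 ≤_) eq au , trans (≡-sym eq) l≡)

  -- `A` stays free for two uses: adjacency to `z` with a label at most m, and membership in the
  -- current vertex list.
  exits : ∀ {A : Fin N → Set} → (∀ {u c} → Bad u → A u → Adj≡ Λ (suc m) c u → A c) → ∀ {r} → Bad r → A r →
          ∃₂ λ y y′ → y ≢ y′ × (¬ Bad y × A y) × (¬ Bad y′ × A y′) × Star (Adj≡ Λ (suc m)) y y′ × ¬ Adj≡ Λ (suc m) y y′
  exits = two-exits Λ (adj≡-sym Λ) (forest Λ mat m) (adj⇒≢ Λ ∘ proj₁) bad? branch

  -- This is (MS3) for the labels up to j at `r`. They are distinct because j + 1 occurs as a label,
  -- so that j ≤ m.
  free : ∀ {j u u′ r} → Bad r → Adj≡ Λ (suc j) u u′ → Adj≤ Λ j u r → ¬ Adj≤ Λ j u′ r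
  free {j} {u} {u′} {r} (_ , ¬clash , _) uu′ ur u′r =
    n≮n (label Λ u u′) (≤-trans (proj₂ (neighbours-nested Λ mat distinct′ ur u′r (adj⇒≢ Λ (proj₁ uu′))))
      (≤-trans (⊔-lub (proj₂ ur) (proj₂ u′r)) (≤-trans (n≤1+n j) (≤-reflexive (≡-sym (proj₂ uu′))))))
    where
    distinct′ : Distinct≤ Λ j r
    distinct′ (e , l) = truncation-distinct ¬clash
      (e , ≤-trans l (≤-pred (subst (_≤ suc m) (proj₂ uu′) (bounded u u′))))

  mat′ : MAT deletion
  mat′ = deletion-MAT free mat

  -- A neighbour r ∈ Bad of z would make two non-adjacent vertices neighbours of z outside Bad.
  lift-distinct : ∀ {z} → z ≢ x → ¬ Bad z → ¬ Clash deletion z → ¬ Clash Λ z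
  lift-distinct {z} z≢x ¬bad ¬clash clash with Fin.any? (λ r → bad? r ×-dec adj≤? Λ m z r)
  ... | yes (r , bad , zr)
        with y , y′ , y≢y′ , (¬by , zy) , (¬by′ , zy′) , path , ¬yy′ ←
             -- By `saturated`, adjacency to `z` with a label at most m spreads from a bad vertex
             -- along edges of label m + 1.
             exits {Adj≤ Λ m z} (λ (_ , ¬c , _) zu cu → saturated Λ mat (truncation-distinct ¬c) (adj≡-sym Λ cu) zu) bad zr
        with e ← ⊑-adj {Λ′ = deletion} {Λ} deletion-⊑
                   (clique (distinct⇒simplicial deletion mat′ ¬clash)
                     (deletion-adj⁺ ¬by ¬bad (adj-sym Λ (proj₁ zy)))
                     (deletion-adj⁺ ¬by′ ¬bad (adj-sym Λ (proj₁ zy′))) y≢y′)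
        with m≤n⇒m<n∨m≡n (bounded y y′)
  -- A label at most m contradicts (ML2); the label m + 1 was excluded by acyclicity.
  ...   | inj₁ l≤m = closed Λ mat path (e , ≤-pred l≤m)
  ...   | inj₂ l≡  = ¬yy′ (e , l≡)
  -- Without bad lower neighbours, all edges at `z` of label at most m survive the deletion, so a
  -- clash at `z` would make `z` itself bad.
  lift-distinct {z} z≢x ¬bad ¬clash clash | no isolated = ¬bad (z≢x , ¬clash-truncation , clash)
    where
    kept : ∀ {a} → Adj truncation a z → Adj deletion a z
    kept e = deletion-adj⁺ (λ bad → isolated (_ , bad , adj≤-sym Λ (truncation-adj⁻ e))) ¬bad (proj₁ (truncation-adj⁻ e))

    agree : ∀ {a} → Adj truncation a z → label deletion a z ≡ label truncation a z
    agree e = trans (deletion-⊑ (kept e)) (≡-sym (truncation-⊑ e))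

    ¬clash-truncation : ¬ Clash truncation z
    ¬clash-truncation (a , b , a≢b , az , eq) =
      ¬clash (a , b , a≢b , kept az , trans (agree az) (trans eq (≡-sym (agree (subst (1 ≤_) eq az)))))

-- `U` lists the vertices not yet deleted, `c` bounds their number for the recursion, and `y`
-- witnesses that `x` is not the only one.
ExistsDistinct : ℕ → ℕ → ℕ → Set
ExistsDistinct N m c = (Λ : Labeling N) (U : List (Fin N)) → length U ≤ c → MAT Λ →
  (∀ u v → label Λ u v ≤ m) → (∀ {u v} → Adj Λ u v → u ∈ U) →
  ∀ {x y} → y ∈ U → y ≢ x → ∃ λ w → w ∈ U × w ≢ x × ¬ Clash Λ w

exists-distinct-step : ∀ {N m} → (∀ c → ExistsDistinct N m c) → ∀ c → ExistsDistinct N (suc m) c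
exists-distinct-step ih zero Λ (_ ∷ _) () mat bounded supp y∈ y≢x
exists-distinct-step {N} {m} ih (suc c) Λ U U≤c mat bounded supp {x} {y} y∈ y≢x
  -- The labels up to m at `v` are distinct; if `v` clashes nevertheless, it lies in B, so deleting
  -- B shortens `U`.
  with v , v∈ , v≢x , v-distinct ← ih (length U) (Truncation.truncation Λ m) U ≤-refl
         (Truncation.truncation-MAT Λ m mat) (Truncation.truncation-≤ Λ m)
         (supp ∘ proj₁ ∘ Truncation.truncation-adj⁻ Λ m) {x} y∈ y≢x
  with clash? Λ v
... | no ¬clash = v , v∈ , v≢x , ¬clash
... | yes clash = let w , w∈ , w≢x , ¬clash = rest in
                  w , proj₁ (∈U′⁻ w∈) , w≢x , lift-distinct w≢x (proj₂ (∈U′⁻ w∈)) ¬clash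
  where
  open Step Λ mat m bounded x

  U′ : List (Fin N)
  U′ = filter (¬? ∘ bad?) U

  ∈U′⁺ : ∀ {u} → u ∈ U → ¬ Bad u → u ∈ U′
  ∈U′⁺ = ∈-filter⁺ (¬? ∘ bad?)

  ∈U′⁻ : ∀ {u} → u ∈ U′ → u ∈ U × ¬ Bad u
  ∈U′⁻ = ∈-filter⁻ (¬? ∘ bad?)

  bad : Bad v
  bad = v≢x , v-distinct , clash

  U′≤c : length U′ ≤ c
  U′≤c = ≤-pred (≤-trans (filter-notAll (¬? ∘ bad?) U (lose v∈ (λ ¬b → ¬b bad))) U≤c)

  -- The two exits differ, so one of them is not `x`.
  start : ∃ λ y → y ∈ U′ × y ≢ x
  start with y , y′ , y≢y′ , (¬by , y∈) , (¬by′ , y′∈) , _ ← exits {_∈ U} (λ _ _ e → supp (proj₁ e)) bad v∈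
        with y Fin.≟ x
  ... | no  y≢x  = y , ∈U′⁺ y∈ ¬by , y≢x
  ... | yes refl = y′ , ∈U′⁺ y′∈ ¬by′ , y≢y′ ∘ ≡-sym

  bounded′ : ∀ u v → label deletion u v ≤ suc m
  bounded′ u v with 1 ≤? label deletion u v
  ... | yes e = subst (_≤ suc m) (≡-sym (deletion-⊑ e)) (bounded u v)
  ... | no ¬e = ≤-trans (≤-pred (≰⇒> ¬e)) z≤n

  rest : ∃ λ w → w ∈ U′ × w ≢ x × ¬ Clash deletion w
  rest = exists-distinct-step ih c deletion U′ U′≤c mat′ bounded′
    (λ e → ∈U′⁺ (supp (⊑-adj {Λ′ = deletion} {Λ} deletion-⊑ e)) (proj₁ (deletion-adj⁻ e)))
    (proj₁ (proj₂ start)) (proj₂ (proj₂ start))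

exists-distinct : ∀ {N} m c → ExistsDistinct N m c
exists-distinct zero c Λ U _ mat bounded supp {y = y} y∈ y≢x =
  y , y∈ , y≢x , λ (u , _ , _ , e , _) → contradiction (≤-trans e (bounded u y)) λ ()
exists-distinct (suc m) = exists-distinct-step (exists-distinct m)

-- Removing a simplicial vertex and changing the vertex set

module _ {N : ℕ} {Λ′ Λ : Labeling N} {v : Fin N} (s : Simplicial Λ v) (sub : Λ′ ⊑ Λ) where

  MAT-remove : (∀ {u w} → Adj Λ′ u w → u ≢ v) → (∀ {u w} → u ≢ v → w ≢ v → Adj Λ u w → Adj Λ′ u w) →
               MAT Λ → MAT Λ′
  MAT-remove away keep = MAT-⊑ {Λ′ = Λ′} {Λ} sub λ {j} {u} {u′} {w} e a b →
    let w≢v : w ≢ v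
        w≢v = λ { refl → simplicial-not-below s (⊑-adj≡ {Λ′ = Λ′} {Λ} sub e) a b }
    in keep (away (proj₁ e)) w≢v (proj₁ a) , keep (away (adj-sym Λ′ (proj₁ e))) w≢v (proj₁ b)

module _ {M N : ℕ} (Λ : Labeling M) (Λ′ : Labeling N) (e : Fin M → Fin N) (e-injective : Injective _≡_ _≡_ e)
         (e-label : ∀ a b → label Λ′ (e a) (e b) ≡ label Λ a b) {v : Fin M}
         (e-image : ∀ {u} → Adj Λ′ u (e v) → ∃ λ a → e a ≡ u) where

  private
    push : ∀ {a b} → Adj Λ a b → Adj Λ′ (e a) (e b)
    push = subst (1 ≤_) (≡-sym (e-label _ _))

    pull : ∀ {a b} → Adj Λ′ (e a) (e b) → Adj Λ a b
    pull = subst (1 ≤_) (e-label _ _)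

  -- Simpliciality looks only at `v` and its neighbours, and `e-image` puts all of these into the
  -- image.
  simplicial-embed⁺ : Simplicial Λ v → Simplicial Λ′ (e v)
  simplicial-embed⁺ s = record
    { clique   = clique′
    ; nested   = nested′
    ; distinct = λ (u , u′ , u≢u′ , uv , eq) → distinct′ u≢u′ uv eq
    ; downward = downward′
    }
    where
    clique′ : ∀ {u u′} → Adj Λ′ u (e v) → Adj Λ′ u′ (e v) → u ≢ u′ → Adj Λ′ u u′
    clique′ uv u′v u≢u′ with a , refl ← e-image uv | b , refl ← e-image u′v =
      push (clique s (pull uv) (pull u′v) (u≢u′ ∘ cong e))

    nested′ : ∀ {u u′} → Adj Λ′ u (e v) → Adj Λ′ u′ (e v) → u ≢ u′ →
              label Λ′ u u′ < label Λ′ u (e v) ⊔ label Λ′ u′ (e v)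
    nested′ uv u′v u≢u′ with a , refl ← e-image uv | b , refl ← e-image u′v
      rewrite e-label a b | e-label a v | e-label b v = nested s uv u′v (u≢u′ ∘ cong e)

    distinct′ : ∀ {u u′} → u ≢ u′ → Adj Λ′ u (e v) → label Λ′ u (e v) ≢ label Λ′ u′ (e v)
    distinct′ u≢u′ uv eq with a , refl ← e-image uv | b , refl ← e-image (subst (1 ≤_) eq uv) =
      distinct s (a , b , u≢u′ ∘ cong e , pull uv , trans (≡-sym (e-label a v)) (trans eq (e-label b v)))

    downward′ : ∀ {u j} → 1 ≤ j → j ≤ label Λ′ u (e v) → ∃ λ u′ → Adj Λ′ u′ (e v) × label Λ′ u′ (e v) ≡ j
    downward′ 1≤j j≤l with a , refl ← e-image (≤-trans 1≤j j≤l)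
      with b , bv , eq ← downward s 1≤j (subst (_ ≤_) (e-label a v) j≤l) = e b , push bv , trans (e-label b v) eq

  simplicial-embed⁻ : Simplicial Λ′ (e v) → Simplicial Λ v
  simplicial-embed⁻ s = record
    { clique   = λ av bv a≢b → pull (clique s (push av) (push bv) (a≢b ∘ e-injective))
    ; nested   = λ {a} {b} av bv a≢b →
        subst₂ _<_ (e-label a b) (cong₂ _⊔_ (e-label a v) (e-label b v)) (nested s (push av) (push bv) (a≢b ∘ e-injective))
    ; distinct = λ (a , b , a≢b , av , eq) →
        distinct s (e a , e b , a≢b ∘ e-injective , push av , trans (e-label a v) (trans eq (≡-sym (e-label b v))))
    ; downward = downward′
    }
    where
    downward′ : ∀ {a j} → 1 ≤ j → j ≤ label Λ a v → ∃ λ b → Adj Λ b v × label Λ b v ≡ j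
    downward′ {a} 1≤j j≤l with u , uv , eq ← downward s {e a} 1≤j (subst (_ ≤_) (≡-sym (e-label a v)) j≤l)
      with b , refl ← e-image uv = b , pull uv , trans (≡-sym (e-label b v)) eq

-- Finite bounds and the choice of a simplicial vertex

-- A missed value put in front of the values of `f` would give an injection of N + 1 points into N.
injective⇒surjective : ∀ {N} {f : Fin N → Fin N} → Injective _≡_ _≡_ f → ∀ y → ∃ λ x → f x ≡ y
injective⇒surjective {N} {f} inj y with Fin.any? (λ x → f x Fin.≟ y)
... | yes found = found
... | no ¬found = contradiction (Fin.injective⇒≤ {f = g} g-injective) (n≮n N)
  where
  g : Fin (suc N) → Fin N
  g Fin.zero    = y
  g (Fin.suc x) = f x

  g-injective : Injective _≡_ _≡_ g
  g-injective {Fin.zero}  {Fin.zero}  _  = refl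
  g-injective {Fin.zero}  {Fin.suc x} eq = contradiction (x , ≡-sym eq) ¬found
  g-injective {Fin.suc x} {Fin.zero}  eq = contradiction (x , eq) ¬found
  g-injective {Fin.suc x} {Fin.suc z} eq = cong Fin.suc (inj eq)

bounded-values : ∀ {N} (f : Fin N → ℕ) → ∃ λ m → ∀ i → f i ≤ m
bounded-values {zero}  f = 0 , λ ()
bounded-values {suc N} f with m , f≤m ← bounded-values (f ∘ Fin.suc) =
  f Fin.zero ⊔ m , λ { Fin.zero → m≤m⊔n _ m ; (Fin.suc i) → m≤n⇒m≤o⊔n (f Fin.zero) (f≤m i) }

bounded-labels : ∀ {N} (Λ : Labeling N) → ∃ λ m → ∀ u v → label Λ u v ≤ m
bounded-labels Λ with m , row≤m ← bounded-values (λ u → proj₁ (bounded-values (label Λ u))) =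
  m , λ u v → ≤-trans (proj₂ (bounded-values (label Λ u)) v) (row≤m u)

module _ {N : ℕ} (Λ : Labeling N) {R : Fin N → Set} (R? : ∀ u → Dec (R u)) where
  open Deletion Λ R?

  -- A lone remaining vertex is isolated. Otherwise `exists-distinct` applies with `y` as the vertex
  -- to avoid.
  exists-simplicial : MAT deletion → ∀ {y} → ¬ R y → ∃ λ w → ¬ R w × Simplicial deletion w
  exists-simplicial mat {y} ¬ry with Fin.any? (λ y′ → ¬? (R? y′) ×-dec ¬? (y′ Fin.≟ y))
  ... | no only = y , ¬ry , distinct⇒simplicial deletion mat
        (λ (u , _ , _ , e , _) → only (u , proj₁ (deletion-adj⁻ e) , adj⇒≢ deletion e))
  ... | yes (y′ , ¬ry′ , y′≢y)
        with m , bounded ← bounded-labels deletion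
        with w , w∈ , _ , ¬clash ← exists-distinct m _ deletion (filter (¬? ∘ R?) (allFin N)) ≤-refl mat bounded
               (λ e → ∈-filter⁺ (¬? ∘ R?) (∈-allFin _) (proj₁ (deletion-adj⁻ e)))
               (∈-filter⁺ (¬? ∘ R?) (∈-allFin y′) ¬ry′) y′≢y
        = w , proj₂ (∈-filter⁻ (¬? ∘ R?) {xs = allFin N} w∈) , distinct⇒simplicial deletion mat ¬clash

MAT-edgeless : ∀ {N} (Λ : Labeling N) → (∀ {u v} → ¬ Adj Λ u v) → MAT Λ
MAT-edgeless Λ none _ _ =
    (λ (_ , _ , _ , _ , e , _) → none e)
  , (λ _ _ _ (e , _) → none e)
  , (λ _ _ (e , _) → contradiction e none)

-- Initial segments of an ordering

module _ {N : ℕ} (σ : Fin N → Fin N) where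

  -- Initial segments are described by the vertices they omit: while an ordering is built from its
  -- end, only its late positions are meaningful.
  Late : ℕ → Fin N → Set
  Late k u = ∃ λ p → k ≤ toℕ p × σ p ≡ u

  late? : ∀ k u → Dec (Late k u)
  late? k u = Fin.any? λ p → (k ≤? toℕ p) ×-dec (σ p Fin.≟ u)

  late-suc⁻ : ∀ {k u} → Late (suc k) u → Late k u
  late-suc⁻ (p , k<p , eq) = p , <⇒≤ k<p , eq

  prefix : Labeling N → ℕ → Labeling N
  prefix Λ k = Deletion.deletion Λ (late? k)

module _ {N : ℕ} (Λ : Labeling N) (σ : Fin N → Fin N) where

  prefix-⊑ : ∀ k → prefix σ Λ k ⊑ prefix σ Λ (suc k)
  prefix-⊑ k e = let ¬u , ¬v = Deletion.deletion-adj⁻ Λ (late? σ k) e in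
    trans (Deletion.deletion-⊑ Λ (late? σ k) e)
      (≡-sym (restrict-label Λ (Deletion.outside? Λ (late? σ (suc k))) swap (¬u ∘ late-suc⁻ σ , ¬v ∘ late-suc⁻ σ)))

  -- Only `σ i` turns late when the bound drops from i + 1 to i.
  prefix-keep : ∀ i {u w} → u ≢ σ i → w ≢ σ i → Adj (prefix σ Λ (suc (toℕ i))) u w → Adj (prefix σ Λ (toℕ i)) u w
  prefix-keep i u≢ w≢ e = let ¬u , ¬w = Deletion.deletion-adj⁻ Λ (late? σ (suc (toℕ i))) e in
    Deletion.deletion-adj⁺ Λ (late? σ (toℕ i)) (early u≢ ¬u) (early w≢ ¬w)
      (⊑-adj {Λ′ = prefix σ Λ (suc (toℕ i))} {Λ} (Deletion.deletion-⊑ Λ (late? σ (suc (toℕ i)))) e)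
    where
    early : ∀ {u} → u ≢ σ i → ¬ Late σ (suc (toℕ i)) u → ¬ Late σ (toℕ i) u
    early u≢ ¬late (p , i≤p , refl) with m≤n⇒m<n∨m≡n i≤p
    ... | inj₁ i<p = ¬late (p , i<p , refl)
    ... | inj₂ i≡p = u≢ (cong σ (Fin.toℕ-injective (≡-sym i≡p)))

module _ (G : LGraph) (σ : Fin (n G) → Fin (n G)) (σ-injective : Injective _≡_ _≡_ σ) (i : Fin (n G)) where

  private
    Λ₁ : Labeling (suc (toℕ i))
    Λ₁ = fromGraph (prefixGraph G σ i)

    Λ₂ : Labeling (n G)
    Λ₂ = prefix σ (fromGraph G) (suc (toℕ i))

    early : Fin (suc (toℕ i)) → Fin (n G)
    early a = inject≤ a (Fin.toℕ<n i)

    early-last : early (fromℕ (toℕ i)) ≡ i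
    early-last = Fin.toℕ-injective (trans (Fin.toℕ-inject≤ _ (Fin.toℕ<n i)) (Fin.toℕ-fromℕ (toℕ i)))

    not-late : ∀ a → ¬ Late σ (suc (toℕ i)) (σ (early a))
    not-late a (p , i<p , eq) with refl ← σ-injective eq =
      n≮n _ (≤-trans i<p (≤-pred (subst (_< suc (toℕ i)) (≡-sym (Fin.toℕ-inject≤ a (Fin.toℕ<n i))) (Fin.toℕ<n a))))

    e-label : ∀ a b → label Λ₂ (σ (early a)) (σ (early b)) ≡ label Λ₁ a b
    e-label a b = restrict-label (fromGraph G) (Deletion.outside? (fromGraph G) (late? σ (suc (toℕ i)))) swap (not-late a , not-late b)

    e-injective : Injective _≡_ _≡_ (σ ∘ early)
    e-injective eq = Fin.inject≤-injective (Fin.toℕ<n i) (Fin.toℕ<n i) _ _ (σ-injective eq)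

    -- A vertex with an edge in `Λ₂` is not late, so its position is at most i.
    e-image : ∀ {u w} → Adj Λ₂ u w → ∃ λ a → σ (early a) ≡ u
    e-image {u} e with p , refl ← injective⇒surjective σ-injective u =
      fromℕ< p<  , cong σ (Fin.toℕ-injective (trans (Fin.toℕ-inject≤ _ (Fin.toℕ<n i)) (Fin.toℕ-fromℕ< p<)))
      where
      p< : toℕ p < suc (toℕ i)
      p< = ≰⇒> λ i<p → proj₁ (Deletion.deletion-adj⁻ (fromGraph G) (late? σ (suc (toℕ i))) e) (p , i<p , refl)

  prefixGraph-simplicial⁺ : Simplicial Λ₂ (σ i) → IsMATSimplicial (prefixGraph G σ i) (fromℕ (toℕ i))
  prefixGraph-simplicial⁺ s = simplicial⇒MATSimplicial Λ₁ _
    (simplicial-embed⁻ Λ₁ Λ₂ (σ ∘ early) e-injective e-label e-image (subst (Simplicial Λ₂ ∘ σ) (≡-sym early-last) s))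

  prefixGraph-simplicial⁻ : IsMATSimplicial (prefixGraph G σ i) (fromℕ (toℕ i)) → Simplicial Λ₂ (σ i)
  prefixGraph-simplicial⁻ s = subst (Simplicial Λ₂ ∘ σ) early-last
    (simplicial-embed⁺ Λ₁ Λ₂ (σ ∘ early) e-injective e-label e-image (MATSimplicial⇒simplicial Λ₁ _ s))

-- From orderings to MAT-labelings and back

module _ {N : ℕ} (Λ : Labeling N) where

  -- At stage 0 every vertex is late, so there are no edges; each further stage is one use of
  -- `MAT-extend`.
  prefix-MAT : (σ : Fin N → Fin N) → Injective _≡_ _≡_ σ → (∀ i → Simplicial (prefix σ Λ (suc (toℕ i))) (σ i)) →
               ∀ k → k ≤ N → MAT (prefix σ Λ k)
  prefix-MAT σ inj s zero _ = MAT-edgeless (prefix σ Λ 0) λ {u} e →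
    proj₁ (Deletion.deletion-adj⁻ Λ (late? σ 0) e) (proj₁ (injective⇒surjective inj u) , z≤n , proj₂ (injective⇒surjective inj u))
  prefix-MAT σ inj s (suc k) k<N = subst (λ k → MAT (prefix σ Λ (suc k))) (Fin.toℕ-fromℕ< k<N)
    (MAT-extend {Λ′ = prefix σ Λ (toℕ i)} {prefix σ Λ (suc (toℕ i))} (s i) (prefix-⊑ Λ σ (toℕ i)) (prefix-keep Λ σ i)
      (subst (λ k → MAT (prefix σ Λ k)) (≡-sym (Fin.toℕ-fromℕ< k<N)) (prefix-MAT σ inj s k (<⇒≤ k<N))))
    where
    i : Fin N
    i = fromℕ< k<N

  peo⇒MAT : (σ : Fin N → Fin N) → Injective _≡_ _≡_ σ → (∀ i → Simplicial (prefix σ Λ (suc (toℕ i))) (σ i)) → MAT Λ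
  peo⇒MAT σ inj s = MAT-⊑ {Λ′ = Λ} {prefix σ Λ N}
    (λ _ → ≡-sym (restrict-label Λ (Deletion.outside? Λ (late? σ N)) swap (none , none)))
    (λ _ a b → up (proj₁ a) , up (proj₁ b))
    (prefix-MAT σ inj s N ≤-refl)
    where
    none : ∀ {u} → ¬ Late σ N u
    none (p , N≤p , _) = n≮n _ (≤-trans (Fin.toℕ<n p) N≤p)

    up : ∀ {u v} → Adj (prefix σ Λ N) u v → Adj Λ u v
    up = ⊑-adj {Λ′ = prefix σ Λ N} {Λ} (Deletion.deletion-⊑ Λ (late? σ N))

  -- An ordering settled from position `k` on; the values of `order` below `k` are placeholders.
  record Peeled (k : ℕ) : Set where
    field
      order      : Fin N → Fin N
      injective  : ∀ {p q} → k ≤ toℕ p → k ≤ toℕ q → order p ≡ order q → p ≡ q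
      simplicial : ∀ p → k ≤ toℕ p → Simplicial (prefix order Λ (suc (toℕ p))) (order p)
      mat        : MAT (prefix order Λ k)

  -- Position i receives a simplicial vertex of the remaining graph. This does not change which
  -- vertices are late for any bound above i, so the graphs of the later positions stay the same.
  peel : ∀ i → Peeled (suc (toℕ i)) → Peeled (toℕ i)
  peel i peeled = record
    { order      = τ′
    ; injective  = injective′
    ; simplicial = simplicial′
    ; mat        = MAT-remove {Λ′ = prefix τ′ Λ (toℕ i)} {prefix τ′ Λ (suc (toℕ i))} {τ′ i}
        (simplicial′ i ≤-refl)
        (prefix-⊑ Λ τ′ (toℕ i))
        (λ e u≡ → proj₁ (Deletion.deletion-adj⁻ Λ (late? τ′ (toℕ i)) e) (i , ≤-refl , ≡-sym u≡))
        (prefix-keep Λ τ′ i)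
        mat′
    }
    where
    open Peeled peeled renaming (order to τ)

    -- If all vertices were late, sending each to its position would be injective, hence onto,
    -- although position i is never hit.
    some-early : ∃ λ y → ¬ Late τ (suc (toℕ i)) y
    some-early with Fin.any? (λ y → ¬? (late? τ (suc (toℕ i)) y))
    ... | yes found = found
    ... | no ¬found = contradiction (proj₁ (proj₂ (all-late y))) (λ i<p → n≮n (toℕ i) (subst (λ p → toℕ i < toℕ p) eq i<p))
      where
      all-late : ∀ y → Late τ (suc (toℕ i)) y
      all-late y = decidable-stable (late? τ (suc (toℕ i)) y) (¬found ∘ (y ,_))

      position-injective : Injective _≡_ _≡_ (proj₁ ∘ all-late)
      position-injective {y} {y′} eq =
        trans (≡-sym (proj₂ (proj₂ (all-late y)))) (trans (cong τ eq) (proj₂ (proj₂ (all-late y′))))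

      y : Fin N
      y = proj₁ (injective⇒surjective position-injective i)

      eq : proj₁ (all-late y) ≡ i
      eq = proj₂ (injective⇒surjective position-injective i)

    next : ∃ λ w → ¬ Late τ (suc (toℕ i)) w × Simplicial (prefix τ Λ (suc (toℕ i))) w
    next = exists-simplicial Λ (late? τ (suc (toℕ i))) mat (proj₂ some-early)

    w : Fin N
    w = proj₁ next

    τ′ : Fin N → Fin N
    τ′ = updateAt τ i (const w)

    τ′-here : τ′ i ≡ w
    τ′-here = updateAt-updates i τ

    τ′-later : ∀ {p} → toℕ i < toℕ p → τ′ p ≡ τ p
    τ′-later {p} i<p = updateAt-minimal p i τ (λ { refl → n≮n _ i<p })

    late⇒ : ∀ {k u} → toℕ i < k → Late τ′ k u → Late τ k u
    late⇒ i<k (p , k≤p , eq) = p , k≤p , trans (≡-sym (τ′-later (≤-trans i<k k≤p))) eq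

    late⇐ : ∀ {k u} → toℕ i < k → Late τ k u → Late τ′ k u
    late⇐ i<k (p , k≤p , eq) = p , k≤p , trans (τ′-later (≤-trans i<k k≤p)) eq

    same : ∀ {k} → toℕ i < k → ∀ u v → label (prefix τ′ Λ k) u v ≡ label (prefix τ Λ k) u v
    same i<k = deletion-cong Λ (late? τ′ _) (late? τ _) (late⇒ i<k) (late⇐ i<k)

    transport : ∀ {k v} → toℕ i < k → Simplicial (prefix τ Λ k) v → Simplicial (prefix τ′ Λ k) v
    transport {k} i<k = simplicial-embed⁺ (prefix τ Λ k) (prefix τ′ Λ k) id id (same i<k) (λ {u} _ → u , refl)

    mat′ : MAT (prefix τ′ Λ (suc (toℕ i)))
    mat′ = MAT-⊑ {Λ′ = prefix τ′ Λ (suc (toℕ i))} {prefix τ Λ (suc (toℕ i))} (λ _ → same ≤-refl _ _)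
      (λ _ a b → subst (1 ≤_) (≡-sym (same ≤-refl _ _)) (proj₁ a) , subst (1 ≤_) (≡-sym (same ≤-refl _ _)) (proj₁ b)) mat

    injective′ : ∀ {p q} → toℕ i ≤ toℕ p → toℕ i ≤ toℕ q → τ′ p ≡ τ′ q → p ≡ q
    injective′ {p} {q} i≤p i≤q eq with m≤n⇒m<n∨m≡n i≤p | m≤n⇒m<n∨m≡n i≤q
    ... | inj₁ i<p | inj₁ i<q = injective i<p i<q (trans (≡-sym (τ′-later i<p)) (trans eq (τ′-later i<q)))
    ... | inj₂ i≡p | inj₂ i≡q = Fin.toℕ-injective (trans (≡-sym i≡p) i≡q)
    ... | inj₁ i<p | inj₂ i≡q with refl ← Fin.toℕ-injective i≡q =
      contradiction (p , i<p , trans (≡-sym (τ′-later i<p)) (trans eq τ′-here)) (proj₁ (proj₂ next))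
    ... | inj₂ i≡p | inj₁ i<q with refl ← Fin.toℕ-injective i≡p =
      contradiction (q , i<q , trans (≡-sym (τ′-later i<q)) (trans (≡-sym eq) τ′-here)) (proj₁ (proj₂ next))

    simplicial′ : ∀ p → toℕ i ≤ toℕ p → Simplicial (prefix τ′ Λ (suc (toℕ p))) (τ′ p)
    simplicial′ p i≤p with m≤n⇒m<n∨m≡n i≤p
    ... | inj₁ i<p = transport (s≤s i≤p) (subst (Simplicial _) (≡-sym (τ′-later i<p)) (simplicial p i<p))
    ... | inj₂ i≡p with refl ← Fin.toℕ-injective i≡p =
      transport ≤-refl (subst (Simplicial _) (≡-sym τ′-here) (proj₂ (proj₂ next)))

  -- `d` counts the settled positions.
  peel-all : MAT Λ → ∀ d {k} → d + k ≡ N → Peeled k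
  peel-all mat zero refl = record
    -- `id` is a placeholder: no position has been settled.
    { order      = id
    ; injective  = λ N≤p → contradiction (≤-trans (Fin.toℕ<n _) N≤p) (n≮n _)
    ; simplicial = λ p N≤p → contradiction (≤-trans (Fin.toℕ<n p) N≤p) (n≮n _)
    ; mat        = Deletion.deletion-MAT Λ (late? id N)
        (λ (p , N≤p , _) → contradiction (≤-trans (Fin.toℕ<n p) N≤p) (n≮n _)) mat
    }
  peel-all mat (suc d) {k} eq = subst Peeled (Fin.toℕ-fromℕ< k<N)
    (peel (fromℕ< k<N) (subst (Peeled ∘ suc) (≡-sym (Fin.toℕ-fromℕ< k<N)) (peel-all mat d (trans (+-suc d k) eq))))
    where
    k<N : k < N
    k<N = subst (k <_) eq (s≤s (m≤n+m k d))

theorem5p5 : (G : LGraph) → IsMATLabeling G ⇔ Σ (Fin (n G) → Fin (n G)) (λ σ → IsMATPEO G σ)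
theorem5p5 G = mk⇔ to from
  where
  to : IsMATLabeling G → Σ (Fin (n G) → Fin (n G)) (λ σ → IsMATPEO G σ)
  to mat = order , σ-injective , λ i → prefixGraph-simplicial⁺ G order σ-injective i (simplicial i z≤n)
    where
    open Peeled (peel-all (fromGraph G) mat (n G) (+-identityʳ (n G))) using (order; injective; simplicial)

    σ-injective : Injective _≡_ _≡_ order
    σ-injective = injective z≤n z≤n

  from : Σ (Fin (n G) → Fin (n G)) (λ σ → IsMATPEO G σ) → IsMATLabeling G
  from (σ , inj , s) = peo⇒MAT (fromGraph G) σ inj (λ i → prefixGraph-simplicial⁻ G σ inj i (s i))
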